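{- Let $\mathbb K$ be a field of characteristic $p>2$, $\Lambda_1,\dots,\Lambda_n\in\mathbb F_p^\times\subset\mathbb K$, $a\in\mathbb K\setminus\mathbb F_p$, and let $x^0\in\mathbb K^n$ be such that all $2np$ linear polynomials $s-x_i^0+\Lambda_i+aj$, $s-x_i^0+aj$ ($i=1,\dots,n$, $j=0,\dots,p-1$) in $s$ are pairwise distinct. Let $s_i(\varepsilon)\in\mathbb K[[\varepsilon]]$, $i=1,\dots,n$, be the formal branches defined in the context, and $\Phi(s,x)=\varepsilon^{ -1}\prod_{l=1}^n\frac{s-x_l+\Lambda_l}{s-x_l+a}$. Then for $i=1,\dots,n$ and $d=1,\dots,p-1$, $$\prod_{j=0}^{d-1}\Phi(s_i(\varepsilon)+aj,x^0)=\mathcal O(\varepsilon^{p-d}).$$ In particular, this product is $\mathcal O(\varepsilon)$.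
   Context: $\mathbb F_p$ is the prime subfield of $\mathbb K$, $n\ge1$. For $i=1,\dots,n$ put $y_i^0=x_i^0-\Lambda_i$; $s_i(\varepsilon)\in\mathbb K[[\varepsilon]]$ is the unique formal power series with $s_i(0)=y_i^0$ satisfying $$\prod_{l=1}^n\prod_{j=0}^{p-1}(s-x_l^0+\Lambda_l+aj)=\varepsilon^p\prod_{l=1}^n\prod_{j=0}^{p-1}(s-x_l^0+aj)$$ at $s=s_i(\varepsilon)$. ($\varepsilon=\kappa^{ -1}$ where $\kappa$ is the twist parameter of the qKZ connection.) For $N\ge 0$, an element of $\mathbb K((\varepsilon))$ is $\mathcal O(\varepsilon^N)$ if it lies in $\varepsilon^N\mathbb K[[\varepsilon]]$. -}

module Defs where

open import Level using (Level; _⊔_)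
open import Algebra.Bundles using (RawRing)
open import Algebra.Apartness.Bundles using (HeytingField)
import Algebra.Definitions
import Algebra.Definitions.RawSemiring
open import Data.Fin.Base using (Fin; toℕ)
open import Data.Nat.Base as ℕ using (ℕ; zero; suc; _∸_)
open import Data.Nat.Divisibility using (_∣_)
open import Data.Product.Base using (_×_; _,_; ∃-syntax; proj₁)
open import Data.Sum.Base using (_⊎_; inj₁; inj₂)
open import Data.Vec.Functional using (Vector; []; _∷_)
open import Function.Bundles using (_⇔_)
open import Relation.Binary.PropositionalEquality using (_≢_)

private
  variable
    c ℓ ℓ₁ ℓ₂ : Level

module RingNotation (R : RawRing c ℓ) where

  open RawRing R public
  open Algebra.Definitions.RawSemiring rawSemiring public
    using (product; sum; _^_) renaming (_×_ to _·_)

  infixl 6 _-_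
  infixl 7 _/_by_

  _-_ : Carrier → Carrier → Carrier
  x - y = x + (- y)

  IsInvertible : Carrier → Set (c ⊔ ℓ)
  IsInvertible = Algebra.Definitions.Invertible _≈_ 1# _*_

  _/_by_ : Carrier → (v : Carrier) → IsInvertible v → Carrier
  u / v by inv = u * proj₁ inv

-- R[[ε]]: a series is its sequence of coefficients.

module PowerSeries (R : RawRing c ℓ) where

  private module R = RingNotation R

  Series : Set c
  Series = ℕ → R.Carrier

  const : R.Carrier → Series
  const r zero    = r
  const r (suc _) = R.0#

  ε : Series
  ε 1 = R.1#
  ε _ = R.0#

  rawRing : RawRing c ℓ
  rawRing = record
    { Carrier = Series
    ; _≈_     = λ f g → ∀ m → f m R.≈ g m
    ; _+_     = λ f g m → f m R.+ g m
    ; _*_     = λ f g m → R.sum {suc m} λ k → f (toℕ k) R.* g (m ∸ toℕ k)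
    ; -_      = λ f m → R.- f m
    ; 0#      = const R.0#
    ; 1#      = const R.1#
    }

-- R((ε)), as the localisation of R[[ε]] at ε.

module LaurentSeries (R : RawRing c ℓ) where

  open PowerSeries R using (Series; ε)
  private module S = RingNotation (PowerSeries.rawRing R)

  -- ε^-[ k ] f  denotes  ε⁻ᵏ f.  The representation is not unique, whence
  -- the equality of rawRing below.
  record Laurent : Set c where
    constructor ε^-[_]_
    field
      pole   : ℕ
      series : Series

  open Laurent

  ι : Series → Laurent
  ι f = ε^-[ 0 ] f

  ε⁻¹ : Laurent
  ε⁻¹ = ε^-[ 1 ] S.1#

  rawRing : RawRing c ℓ
  rawRing = record
    { Carrier = Laurent
    ; _≈_     = λ u v → (ε S.^ pole v) S.* series u S.≈ (ε S.^ pole u) S.* series v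
    ; _+_     = λ u v → ε^-[ pole u ℕ.+ pole v ]
                          ((ε S.^ pole v) S.* series u S.+ (ε S.^ pole u) S.* series v)
    ; _*_     = λ u v → ε^-[ pole u ℕ.+ pole v ] (series u S.* series v)
    ; -_      = λ u → ε^-[ pole u ] (S.- series u)
    ; 0#      = ι S.0#
    ; 1#      = ι S.1#
    }

  -- u = O(ε ^ N)
  IsO : ℕ → Laurent → Set (c ⊔ ℓ)
  IsO N u = ∃[ h ] RawRing._≈_ rawRing u (ι ((ε S.^ N) S.* h))

module OverField (F : HeytingField c ℓ₁ ℓ₂) where

  private
    module F = HeytingField F
    R : RawRing _ _
    R = record
      { Carrier = F.Carrier ; _≈_ = F._≈_ ; _+_ = F._+_ ; _*_ = F._*_
      ; -_ = F.-_ ; 0# = F.0# ; 1# = F.1# }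
    module K = RingNotation R
    module S = RingNotation (PowerSeries.rawRing R)
    module L = RingNotation (LaurentSeries.rawRing R)

  open PowerSeries R public using (Series; const; ε)
  open LaurentSeries R public using (Laurent; ι; ε⁻¹; IsO)
  open L public using () renaming (product to ∏ᴸ; IsInvertible to IsInvertibleᴸ)

  HasCharacteristic : ℕ → Set ℓ₁
  HasCharacteristic p = ∀ m → (m K.· K.1# K.≈ K.0#) ⇔ (p ∣ m)

  -- Membership in the prime subfield, for a field of characteristic p > 0.
  _∈𝔽_ : K.Carrier → ℕ → Set ℓ₁
  x ∈𝔽 p = ∃[ m ] x K.≈ toℕ {p} m K.· K.1#

  -- A polynomial of degree at most 1 in s, by its coefficients of 1 and s.
  Linear : Set c
  Linear = Vector K.Carrier 2

  s+_ : K.Carrier → Linear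
  s+ b = b ∷ K.1# ∷ []

  -- Distinctness is expressed by the apartness of the field, which
  -- classically is the negation of _≈_.
  _#ˡ_ : Linear → Linear → Set ℓ₂
  f #ˡ g = ∃[ k ] f k F.# g k

  module _ (p : ℕ) {n : ℕ} (Λ : Vector K.Carrier n) (a : K.Carrier) where

    -- inj₁ (i , j) gives s - xᵢ + Λᵢ + aj and inj₂ (i , j) gives s - xᵢ + aj.
    factor : Vector K.Carrier n → (Fin n × Fin p) ⊎ (Fin n × Fin p) → Linear
    factor x (inj₁ (i , j)) = s+ (K.- x i K.+ Λ i K.+ toℕ j K.· a)
    factor x (inj₂ (i , j)) = s+ (K.- x i K.+ toℕ j K.· a)

    FactorsDistinct : Vector K.Carrier n → Set ℓ₂
    FactorsDistinct x = ∀ u v → u ≢ v → factor x u #ˡ factor x v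

    record IsBranch (x : Vector K.Carrier n) (i : Fin n) (s : Series) : Set ℓ₁ where
      field
        initial  : s 0 K.≈ x i K.- Λ i
        equation :
          S.product (λ l → S.product {p} λ j →
            s S.- const (x l) S.+ const (Λ l) S.+ const (toℕ j K.· a))
          S.≈
          (ε S.^ p) S.* S.product (λ l → S.product {p} λ j →
            s S.- const (x l) S.+ const (toℕ j K.· a))

  module _ {n : ℕ} (Λ : Vector K.Carrier n) (a : K.Carrier) where

    numerator denominator : Series → Vector K.Carrier n → Fin n → Laurent
    numerator   s x l = ι (s S.- const (x l) S.+ const (Λ l))
    denominator s x l = ι (s S.- const (x l) S.+ const a)

    -- Φ is a rational function, so evaluating it at a series in K[[ε]]
    -- requires its denominators to be nonzero, i.e. invertible, in K((ε)).
    Regular : Series → Vector K.Carrier n → Set (c ⊔ ℓ₁)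
    Regular s x = ∀ l → IsInvertibleᴸ (denominator s x l)

    Φ : (s : Series) (x : Vector K.Carrier n) → Regular s x → Laurent
    Φ s x reg = ε⁻¹ L.* ∏ᴸ λ l → numerator s x l L./ denominator s x l by reg l

  shift : Series → K.Carrier → ℕ → Series
  shift s a j = s S.+ const (j K.· a)

{-# OPTIONS --safe #-}
module Submission where

-- At ε = 0 every factor of the defining equation other than s − xᵢ + Λᵢ is a
-- unit of K[[ε]], because the linear factors are distinct; hence εᵖ divides
-- s − xᵢ + Λᵢ.  For d ≤ p − 1 the denominators of the product of the Φ's are
-- among these units, so the product has a numerator divisible by εᵖ over εᵈ.

open import Defs
open import Algebra.Bundles using (CommutativeMonoid; CommutativeRing)
open import Algebra.Apartness.Bundles using (HeytingField)
import Algebra.Definitions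
import Algebra.Definitions.RawMonoid
import Algebra.Properties.AbelianGroup
import Algebra.Properties.CommutativeMonoid
import Algebra.Properties.CommutativeSemigroup
import Algebra.Properties.CommutativeSemigroup.Divisibility
import Algebra.Properties.Semiring.Exp
open import Data.Fin.Base using (Fin; zero; suc; toℕ; fromℕ<)
open import Data.Fin.Properties using (toℕ-fromℕ<; toℕ<n; suc-injective)
open import Data.Maybe.Base using (nothing)
open import Data.Nat.Base as ℕ using (ℕ; zero; suc; _∸_; _≤_; _<_; s≤s)
import Data.Nat.Properties as ℕ
open import Data.Product.Base using (_×_; _,_; Σ-syntax; proj₁)
open import Data.Product.Properties using (,-injectiveˡ; ,-injectiveʳ)
open import Data.Sum.Base using (_⊎_; inj₁; inj₂)
open import Data.Sum.Properties using (inj₁-injective)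
open import Data.Vec.Functional using (Vector)
open import Function.Base using (_∘_)
open import Relation.Binary.PropositionalEquality as ≡ using (_≡_; _≢_)
import Relation.Binary.Reasoning.Setoid
open import Relation.Nullary.Negation.Core using (¬_; contradiction)
open import Tactic.RingSolver using (solve-∀)
open import Tactic.RingSolver.Core.AlmostCommutativeRing
  using (AlmostCommutativeRing; fromCommutativeRing)

module InvertibleFactors {c ℓ} (M : CommutativeMonoid c ℓ) where

  open CommutativeMonoid M renaming (ε to 1#)
  open Algebra.Definitions _≈_ using (Invertible)
  open Algebra.Definitions.RawMonoid rawMonoid using (_∣_; _,_) renaming (sum to product)
  open Algebra.Properties.CommutativeMonoid M using (invertibleʳ⇒invertible)
  open Algebra.Properties.CommutativeSemigroup commutativeSemigroup using (interchange; xy∙z≈xz∙y)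
  open Algebra.Properties.CommutativeSemigroup.Divisibility commutativeSemigroup
    using (∣ʳ-respʳ-≈; x∣ʳy⇒x∣ʳzy)
  open Relation.Binary.Reasoning.Setoid setoid

  IsInvertible : Carrier → Set _
  IsInvertible = Invertible 1# _∙_

  product-invertible : ∀ {n} (t : Vector Carrier n) →
                       (∀ j → IsInvertible (t j)) → IsInvertible (product t)
  product-invertible {zero}  t inv = 1# , identityˡ 1# , identityˡ 1#
  product-invertible {suc n} t inv
    with inv zero | product-invertible (t ∘ suc) (inv ∘ suc)
  ... | u , _ , tu≈1 | v , _ , sv≈1 = invertibleʳ⇒invertible (u ∙ v , (begin
    (t zero ∙ product (t ∘ suc)) ∙ (u ∙ v)  ≈⟨ interchange _ _ _ _ ⟩
    (t zero ∙ u) ∙ (product (t ∘ suc) ∙ v)  ≈⟨ ∙-cong tu≈1 sv≈1 ⟩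
    1# ∙ 1#                                 ≈⟨ identityˡ 1# ⟩
    1#                                      ∎))

  ∣-product : ∀ {n x} (t : Vector Carrier n) k → x ∣ t k → x ∣ product t
  ∣-product t zero    x∣tₖ = ∣ʳ-respʳ-≈ (comm _ _) (x∣ʳy⇒x∣ʳzy _ x∣tₖ)
  ∣-product t (suc k) x∣tₖ = x∣ʳy⇒x∣ʳzy _ (∣-product (t ∘ suc) k x∣tₖ)

  ∣-cancel-invertibleʳ : ∀ {x y u} → IsInvertible u → x ∣ y ∙ u → x ∣ y
  ∣-cancel-invertibleʳ {x} {y} {u} (v , _ , uv≈1) (q , qx≈yu) = q ∙ v , (begin
    (q ∙ v) ∙ x  ≈⟨ xy∙z≈xz∙y q v x ⟩
    (q ∙ x) ∙ v  ≈⟨ ∙-congʳ qx≈yu ⟩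
    (y ∙ u) ∙ v  ≈⟨ assoc y u v ⟩
    y ∙ (u ∙ v)  ≈⟨ ∙-congˡ uv≈1 ⟩
    y ∙ 1#       ≈⟨ identityʳ y ⟩
    y            ∎)

  ∣-product⇒∣ : ∀ {n x} (t : Vector Carrier n) k →
                (∀ j → j ≢ k → IsInvertible (t j)) → x ∣ product t → x ∣ t k
  ∣-product⇒∣ t zero inv =
    ∣-cancel-invertibleʳ (product-invertible (t ∘ suc) λ j → inv (suc j) λ ())
  ∣-product⇒∣ t (suc k) inv x∣∏ =
    ∣-product⇒∣ (t ∘ suc) k (λ j j≢k → inv (suc j) (j≢k ∘ suc-injective))
      (∣-cancel-invertibleʳ (inv zero λ ()) (∣ʳ-respʳ-≈ (comm _ _) x∣∏))

module PowerSeriesProperties {c ℓ} (K : CommutativeRing c ℓ) where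

  private module K = CommutativeRing K
  open PowerSeries K.rawRing
  private module S = RingNotation rawRing
  open Algebra.Properties.CommutativeSemigroup K.+-commutativeSemigroup
    using (interchange; x∙yz≈y∙xz)
  open Relation.Binary.Reasoning.Setoid K.setoid

  tail : Series → Series
  tail f m = f (suc m)

  scale : K.Carrier → Series → Series
  scale r f m = r K.* f m

  -- By computation, (f * g) (suc m) = f 0 * g (suc m) + (tail f * g) m, so the
  -- laws of the Cauchy product follow by induction on the coefficient.

  *-cong : ∀ {f f′ g g′} → f S.≈ f′ → g S.≈ g′ → f S.* g S.≈ f′ S.* g′
  *-cong f≈f′ g≈g′ zero    = K.+-congʳ (K.*-cong (f≈f′ 0) (g≈g′ 0))
  *-cong f≈f′ g≈g′ (suc m) =
    K.+-cong (K.*-cong (f≈f′ 0) (g≈g′ (suc m))) (*-cong (f≈f′ ∘ suc) g≈g′ m)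

  *-coeff₀ : ∀ f g → (f S.* g) 0 K.≈ f 0 K.* g 0
  *-coeff₀ f g = K.+-identityʳ _

  *-coeff-sucʳ : ∀ f g m →
                 (f S.* g) (suc m) K.≈ f (suc m) K.* g 0 K.+ (f S.* tail g) m
  *-coeff-sucʳ f g zero = begin
    f 0 K.* g 1 K.+ (f 1 K.* g 0 K.+ K.0#)  ≈⟨ x∙yz≈y∙xz _ _ _ ⟩
    f 1 K.* g 0 K.+ (f 0 K.* g 1 K.+ K.0#)  ∎
  *-coeff-sucʳ f g (suc m) = begin
    f 0 K.* g (2 ℕ.+ m) K.+ (tail f S.* g) (suc m)
      ≈⟨ K.+-congˡ (*-coeff-sucʳ (tail f) g m) ⟩
    f 0 K.* g (2 ℕ.+ m) K.+ (f (2 ℕ.+ m) K.* g 0 K.+ (tail f S.* tail g) m)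
      ≈⟨ x∙yz≈y∙xz _ _ _ ⟩
    f (2 ℕ.+ m) K.* g 0 K.+ (f S.* tail g) (suc m) ∎

  *-comm : ∀ f g → f S.* g S.≈ g S.* f
  *-comm f g zero    = K.+-congʳ (K.*-comm _ _)
  *-comm f g (suc m) = begin
    f 0 K.* g (suc m) K.+ (tail f S.* g) m  ≈⟨ K.+-cong (K.*-comm _ _) (*-comm (tail f) g m) ⟩
    g (suc m) K.* f 0 K.+ (g S.* tail f) m  ≈⟨ *-coeff-sucʳ g f m ⟨
    (g S.* f) (suc m)                       ∎

  *-distribʳ-+ : ∀ f g h → (g S.+ h) S.* f S.≈ (g S.* f) S.+ (h S.* f)
  *-distribʳ-+ f g h zero = begin
    (g 0 K.+ h 0) K.* f 0 K.+ K.0#  ≈⟨ *-coeff₀ (g S.+ h) f ⟩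
    (g 0 K.+ h 0) K.* f 0           ≈⟨ K.distribʳ _ _ _ ⟩
    g 0 K.* f 0 K.+ h 0 K.* f 0     ≈⟨ K.+-cong (*-coeff₀ g f) (*-coeff₀ h f) ⟨
    (g S.* f) 0 K.+ (h S.* f) 0     ∎
  *-distribʳ-+ f g h (suc m) = begin
    (g 0 K.+ h 0) K.* f (suc m) K.+ ((tail g S.+ tail h) S.* f) m
      ≈⟨ K.+-cong (K.distribʳ _ _ _) (*-distribʳ-+ f (tail g) (tail h) m) ⟩
    (g 0 K.* f (suc m) K.+ h 0 K.* f (suc m)) K.+ ((tail g S.* f) m K.+ (tail h S.* f) m)
      ≈⟨ interchange _ _ _ _ ⟩
    (g S.* f) (suc m) K.+ (h S.* f) (suc m) ∎

  scale-* : ∀ r f g → scale r f S.* g S.≈ scale r (f S.* g)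
  scale-* r f g zero = begin
    (r K.* f 0) K.* g 0 K.+ K.0#  ≈⟨ K.+-identityʳ _ ⟩
    (r K.* f 0) K.* g 0           ≈⟨ K.*-assoc _ _ _ ⟩
    r K.* (f 0 K.* g 0)           ≈⟨ K.*-congˡ (*-coeff₀ f g) ⟨
    r K.* (f S.* g) 0             ∎
  scale-* r f g (suc m) = begin
    (r K.* f 0) K.* g (suc m) K.+ (scale r (tail f) S.* g) m
      ≈⟨ K.+-cong (K.*-assoc _ _ _) (scale-* r (tail f) g m) ⟩
    r K.* (f 0 K.* g (suc m)) K.+ r K.* (tail f S.* g) m
      ≈⟨ K.distribˡ _ _ _ ⟨
    r K.* (f S.* g) (suc m) ∎

  *-assoc : ∀ f g h → (f S.* g) S.* h S.≈ f S.* (g S.* h)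
  *-assoc f g h zero = begin
    (f S.* g) 0 K.* h 0 K.+ K.0#           ≈⟨ K.+-congʳ (K.*-congʳ (*-coeff₀ f g)) ⟩
    (f 0 K.* g 0) K.* h 0 K.+ K.0#         ≈⟨ K.+-congʳ (K.*-assoc _ _ _) ⟩
    f 0 K.* (g 0 K.* h 0) K.+ K.0#         ≈⟨ K.+-congʳ (K.*-congˡ (*-coeff₀ g h)) ⟨
    f 0 K.* (g S.* h) 0 K.+ K.0#           ∎
  *-assoc f g h (suc m) = begin
    (f S.* g) 0 K.* h (suc m) K.+ ((scale (f 0) (tail g) S.+ (tail f S.* g)) S.* h) m
      ≈⟨ K.+-cong (K.*-congʳ (*-coeff₀ f g))
                  (*-distribʳ-+ h (scale (f 0) (tail g)) (tail f S.* g) m) ⟩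
    (f 0 K.* g 0) K.* h (suc m) K.+
      ((scale (f 0) (tail g) S.* h) m K.+ ((tail f S.* g) S.* h) m)
      ≈⟨ K.+-cong (K.*-assoc _ _ _)
                  (K.+-cong (scale-* (f 0) (tail g) h m) (*-assoc (tail f) g h m)) ⟩
    f 0 K.* (g 0 K.* h (suc m)) K.+
      (f 0 K.* (tail g S.* h) m K.+ (tail f S.* (g S.* h)) m)
      ≈⟨ K.+-assoc _ _ _ ⟨
    (f 0 K.* (g 0 K.* h (suc m)) K.+ f 0 K.* (tail g S.* h) m) K.+
      (tail f S.* (g S.* h)) m
      ≈⟨ K.+-congʳ (K.distribˡ _ _ _) ⟨
    f 0 K.* (g S.* h) (suc m) K.+ (tail f S.* (g S.* h)) m ∎

  *-zeroˡ : ∀ f g → (∀ m → f m K.≈ K.0#) → ∀ m → (f S.* g) m K.≈ K.0#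
  *-zeroˡ f g f≈0 zero    = K.trans (*-coeff₀ f g) (K.trans (K.*-congʳ (f≈0 0)) (K.zeroˡ _))
  *-zeroˡ f g f≈0 (suc m) = begin
    f 0 K.* g (suc m) K.+ (tail f S.* g) m
      ≈⟨ K.+-cong (K.*-congʳ (f≈0 0)) (*-zeroˡ (tail f) g (f≈0 ∘ suc) m) ⟩
    K.0# K.* g (suc m) K.+ K.0#  ≈⟨ K.+-identityʳ _ ⟩
    K.0# K.* g (suc m)           ≈⟨ K.zeroˡ _ ⟩
    K.0#                         ∎

  *-identityˡ : ∀ f → S.1# S.* f S.≈ f
  *-identityˡ f zero    = K.trans (*-coeff₀ S.1# f) (K.*-identityˡ _)
  *-identityˡ f (suc m) = begin
    K.1# K.* f (suc m) K.+ (tail S.1# S.* f) m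
      ≈⟨ K.+-cong (K.*-identityˡ _) (*-zeroˡ (tail S.1#) f (λ _ → K.refl) m) ⟩
    f (suc m) K.+ K.0#  ≈⟨ K.+-identityʳ _ ⟩
    f (suc m)           ∎

  0#-coeff : ∀ m → S.0# m K.≈ K.0#
  0#-coeff zero    = K.refl
  0#-coeff (suc m) = K.refl

  commutativeRing : CommutativeRing c ℓ
  commutativeRing = record
    { RingNotation rawRing
    ; isCommutativeRing = record
      { isRing = record
        { +-isAbelianGroup = record
          { isGroup = record
            { isMonoid = record
              { isSemigroup = record
                { isMagma = record
                  { isEquivalence = record
                    { refl  = λ m → K.refl
                    ; sym   = λ f≈g m → K.sym (f≈g m)
                    ; trans = λ f≈g g≈h m → K.trans (f≈g m) (g≈h m)
                    }
                  ; ∙-cong = λ f≈f′ g≈g′ m → K.+-cong (f≈f′ m) (g≈g′ m)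
                  }
                ; assoc = λ f g h m → K.+-assoc _ _ _
                }
              ; identity = +-identityˡ
                         , λ f m → K.trans (K.+-comm _ _) (+-identityˡ f m)
              }
            ; inverse = -‿inverseˡ
                      , λ f m → K.trans (K.+-comm _ _) (-‿inverseˡ f m)
            ; ⁻¹-cong = λ f≈g m → K.-‿cong (f≈g m)
            }
          ; comm = λ f g m → K.+-comm _ _
          }
        ; *-cong     = *-cong
        ; *-assoc    = *-assoc
        ; *-identity = *-identityˡ
                     , λ f m → K.trans (*-comm f S.1# m) (*-identityˡ f m)
        ; distrib    = (λ f g h m → K.trans (*-comm f (g S.+ h) m)
                         (K.trans (*-distribʳ-+ f g h m)
                           (K.+-cong (*-comm g f m) (*-comm h f m))))
                     , *-distribʳ-+
        }
      ; *-comm = *-comm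
      }
    }
    where
    +-identityˡ : ∀ f m → (S.0# S.+ f) m K.≈ f m
    +-identityˡ f m = K.trans (K.+-congʳ (0#-coeff m)) (K.+-identityˡ _)

    -‿inverseˡ : ∀ f m → ((S.- f) S.+ f) m K.≈ S.0# m
    -‿inverseˡ f m = K.trans (K.-‿inverseˡ _) (K.sym (0#-coeff m))

  -- If u inverts the constant term of g, the quotient of f by g has constant
  -- term u * f 0, and its tail is the quotient by g of what remains of f.
  module _ (g : Series) (u : K.Carrier) (ug₀≈1 : u K.* g 0 K.≈ K.1#) where

    remainder : Series → Series
    remainder f = tail f S.- scale (u K.* f 0) (tail g)

    quotient : Series → Series
    quotient f zero    = u K.* f 0
    quotient f (suc m) = quotient (remainder f) m

    quotient-* : ∀ f → quotient f S.* g S.≈ f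
    quotient-* f zero = begin
      (quotient f S.* g) 0    ≈⟨ *-coeff₀ (quotient f) g ⟩
      (u K.* f 0) K.* g 0     ≈⟨ K.*-congʳ (K.*-comm _ _) ⟩
      (f 0 K.* u) K.* g 0     ≈⟨ K.*-assoc _ _ _ ⟩
      f 0 K.* (u K.* g 0)     ≈⟨ K.*-congˡ ug₀≈1 ⟩
      f 0 K.* K.1#            ≈⟨ K.*-identityʳ _ ⟩
      f 0                     ∎
    quotient-* f (suc m) = begin
      q₀g K.+ (quotient (remainder f) S.* g) m  ≈⟨ K.+-congˡ (quotient-* (remainder f) m) ⟩
      q₀g K.+ (f (suc m) K.- q₀g)               ≈⟨ K.+-comm _ _ ⟩
      (f (suc m) K.- q₀g) K.+ q₀g               ≈⟨ K.+-assoc _ _ _ ⟩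
      f (suc m) K.+ (K.- q₀g K.+ q₀g)           ≈⟨ K.+-congˡ (K.-‿inverseˡ _) ⟩
      f (suc m) K.+ K.0#                        ≈⟨ K.+-identityʳ _ ⟩
      f (suc m)                                 ∎
      where
      q₀g : K.Carrier
      q₀g = (u K.* f 0) K.* g (suc m)

  coeff₀-invertible⇒invertible : ∀ {f} →
    RingNotation.IsInvertible K.rawRing (f 0) → S.IsInvertible f
  coeff₀-invertible⇒invertible {f} (u , uf₀≈1 , _) =
    invertibleˡ⇒invertible (quotient f u uf₀≈1 S.1# , quotient-* f u uf₀≈1 S.1#)
    where
    open Algebra.Properties.CommutativeMonoid (CommutativeRing.*-commutativeMonoid commutativeRing)
      using (invertibleˡ⇒invertible)

module LaurentSeriesProperties {c ℓ} (K : CommutativeRing c ℓ) where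

  open PowerSeriesProperties K using (commutativeRing)
  open CommutativeRing commutativeRing hiding (rawRing; zero)
  open PowerSeries (CommutativeRing.rawRing K) using (Series; ε)
  open LaurentSeries (CommutativeRing.rawRing K)
  open Laurent
  open Algebra.Properties.Semiring.Exp semiring using (_^_; ^-homo-*)
  open Algebra.Definitions.RawMonoid *-rawMonoid using (_∣_; _,_)
  open Relation.Binary.Reasoning.Setoid setoid
  private
    module S = RingNotation (PowerSeries.rawRing (CommutativeRing.rawRing K))
    module L = RingNotation rawRing

  series-product : ∀ {n} (u : Vector Laurent n) →
                   series (L.product u) ≡ S.product (series ∘ u)
  series-product {zero}  u = ≡.refl
  series-product {suc n} u = ≡.cong (series (u zero) *_) (series-product (u ∘ suc))

  pole-product : ∀ {n k} (u : Vector Laurent n) →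
                 (∀ j → pole (u j) ≡ k) → pole (L.product u) ≡ n ℕ.* k
  pole-product {zero}  u eq = ≡.refl
  pole-product {suc n} u eq = ≡.cong₂ ℕ._+_ (eq zero) (pole-product (u ∘ suc) (eq ∘ suc))

  ι-invertible : ∀ {f} → S.IsInvertible f → L.IsInvertible (ι f)
  ι-invertible (g , gf≈1 , fg≈1) = ι g , *-congˡ {S.1#} gf≈1 , *-congˡ {S.1#} fg≈1

  ∣series⇒IsO : ∀ {M N} u → pole u ℕ.+ N ≤ M → ε ^ M ∣ series u → IsO N u
  ∣series⇒IsO {M} {N} u k+N≤M (q , qεᴹ≈u) = q * ε ^ r , (begin
    1# * series u                           ≈⟨ *-identityˡ _ ⟩
    series u                                ≈⟨ qεᴹ≈u ⟨
    q * ε ^ M                               ≡⟨ ≡.cong (λ m → q * ε ^ m) (ℕ.m+[n∸m]≡n k+N≤M) ⟨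
    q * ε ^ (k ℕ.+ N ℕ.+ r)                 ≈⟨ *-congˡ {q} (^-homo-* ε (k ℕ.+ N) r) ⟩
    q * (ε ^ (k ℕ.+ N) * ε ^ r)             ≈⟨ x∙yz≈y∙xz q (ε ^ (k ℕ.+ N)) (ε ^ r) ⟩
    ε ^ (k ℕ.+ N) * (q * ε ^ r)             ≈⟨ *-congʳ {q * ε ^ r} (^-homo-* ε k N) ⟩
    (ε ^ k * ε ^ N) * (q * ε ^ r)           ≈⟨ *-assoc (ε ^ k) (ε ^ N) (q * ε ^ r) ⟩
    ε ^ k * (ε ^ N * (q * ε ^ r))           ∎)
    where
    k = pole u
    r = M ∸ (k ℕ.+ N)
    open Algebra.Properties.CommutativeSemigroup *-commutativeSemigroup using (x∙yz≈y∙xz)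

module Branch {c ℓ₁ ℓ₂} (F : HeytingField c ℓ₁ ℓ₂) where

  open HeytingField F using (Carrier; #⇒invertible; #-irrefl; isCommutativeRing)
  open OverField F

  K : CommutativeRing c ℓ₁
  K = record { isCommutativeRing = isCommutativeRing }

  open PowerSeriesProperties K using (commutativeRing; coeff₀-invertible⇒invertible)

  private
    module K where
      open CommutativeRing K public
      open RingNotation (CommutativeRing.rawRing K) public
        using (_·_; IsInvertible)
    module S where
      open CommutativeRing commutativeRing public
      open RingNotation (PowerSeries.rawRing K.rawRing) public
        using (product; _^_; IsInvertible)
    module L = RingNotation (LaurentSeries.rawRing K.rawRing)

  open LaurentSeriesProperties K
  open LaurentSeries.Laurent
  open InvertibleFactors S.*-commutativeMonoid hiding (IsInvertible)
  open Algebra.Definitions.RawMonoid S.*-rawMonoid using (_∣_; _,_)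
  open Algebra.Properties.CommutativeSemigroup.Divisibility S.*-commutativeSemigroup
    using (∣ʳ-respʳ-≈; x∣ʳy⇒x∣ʳzy)
  open Algebra.Properties.CommutativeSemigroup
    (CommutativeRing.+-commutativeSemigroup commutativeRing) using (xy∙z≈xz∙y)

  K-ring : AlmostCommutativeRing c ℓ₁
  K-ring = fromCommutativeRing K λ _ → nothing

  private
    module _ where
      open AlmostCommutativeRing K-ring

      numerator-value : ∀ t y z b → t + (- y + z + b) ≈ t + - y + z + b
      numerator-value = solve-∀ K-ring

      denominator-value : ∀ t y a b → t + (- y + (a + b)) ≈ t + b + - y + a
      denominator-value = solve-∀ K-ring

  difference-value : ∀ y z b → b K.- (K.- y K.+ z K.+ K.0#) K.≈ (y K.- z) K.+ b
  difference-value y z b = begin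
    b K.- (K.- y K.+ z K.+ K.0#)      ≈⟨ K.+-comm _ _ ⟩
    K.- (K.- y K.+ z K.+ K.0#) K.+ b  ≈⟨ K.+-congʳ (K.-‿cong (K.+-identityʳ _)) ⟩
    K.- (K.- y K.+ z) K.+ b           ≈⟨ K.+-congʳ (⁻¹-∙-comm _ _) ⟨
    (K.- (K.- y) K.- z) K.+ b         ≈⟨ K.+-congʳ (K.+-congʳ (⁻¹-involutive y)) ⟩
    (y K.- z) K.+ b                   ∎
    where
    open Algebra.Properties.AbelianGroup K.+-abelianGroup using (⁻¹-∙-comm; ⁻¹-involutive)
    open Relation.Binary.Reasoning.Setoid K.setoid

  invertible-resp-≈ : ∀ {x y} → x K.≈ y → K.IsInvertible x → K.IsInvertible y
  invertible-resp-≈ x≈y (u , ux≈1 , xu≈1) =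
    u , K.trans (K.*-congˡ (K.sym x≈y)) ux≈1 , K.trans (K.*-congʳ (K.sym x≈y)) xu≈1

  #ˡ⇒invertible : ∀ {b b′} → (s+ b) #ˡ (s+ b′) → K.IsInvertible (b K.- b′)
  #ˡ⇒invertible (zero     , b#b′) = #⇒invertible b#b′
  #ˡ⇒invertible (suc zero , 1#1)  = contradiction 1#1 (#-irrefl K.refl)

  module AtBranch {p′ n : ℕ}
           (Λ : Vector Carrier n) (a : Carrier) (x : Vector Carrier n)
           (distinct : FactorsDistinct (suc p′) Λ a x)
           (i : Fin n) (s : Series) (branch : IsBranch (suc p′) Λ a x i s) where

    open IsBranch branch

    private
      p : ℕ
      p = suc p′

    valueAt0 : (Fin n × Fin p) ⊎ (Fin n × Fin p) → Carrier
    valueAt0 v = (x i K.- Λ i) K.+ factor p Λ a x v zero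

    valueAt0-invertible : ∀ {v} → v ≢ inj₁ (i , zero) → K.IsInvertible (valueAt0 v)
    valueAt0-invertible {inj₁ (l , j)} v≢ =
      invertible-resp-≈ (difference-value _ _ _) (#ˡ⇒invertible (distinct _ _ v≢))
    valueAt0-invertible {inj₂ (l , j)} v≢ =
      invertible-resp-≈ (difference-value _ _ _) (#ˡ⇒invertible (distinct _ _ v≢))

    factorSeries : Fin n → Fin p → Series
    factorSeries l j = s S.- const (x l) S.+ const (Λ l) S.+ const (toℕ j K.· a)

    factorSeries-invertible : ∀ l j → (l , j) ≢ (i , zero) → S.IsInvertible (factorSeries l j)
    factorSeries-invertible l j lj≢ = coeff₀-invertible⇒invertible
      (invertible-resp-≈ (K.trans (K.+-congʳ (K.sym initial)) (numerator-value _ _ _ _))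
        (valueAt0-invertible {inj₁ (l , j)} (lj≢ ∘ inj₁-injective)))

    εᵖ∣factorSeries : ε S.^ p ∣ factorSeries i zero
    εᵖ∣factorSeries =
      ∣-product⇒∣ (factorSeries i) zero
        (λ j j≢0 → factorSeries-invertible i j (j≢0 ∘ ,-injectiveʳ))
        (∣-product⇒∣ (λ l → S.product (factorSeries l)) i
          (λ l l≢i → product-invertible (factorSeries l)
            λ j → factorSeries-invertible l j (l≢i ∘ ,-injectiveˡ))
          (∏M , S.trans (S.*-comm ∏M (ε S.^ p)) (S.sym equation)))
      where
      ∏M : Series
      ∏M = S.product λ l → S.product {p} λ j → s S.- const (x l) S.+ const (toℕ j K.· a)

    denominator-invertible : ∀ j → suc j < p → ∀ l →
      S.IsInvertible (shift s a j S.- const (x l) S.+ const a)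
    denominator-invertible j 1+j<p l = coeff₀-invertible⇒invertible
      (invertible-resp-≈ (K.trans (K.+-congʳ (K.sym initial)) (denominator-value _ _ _ _)) inv)
      where
      inv : K.IsInvertible ((x i K.- Λ i) K.+ (K.- x l K.+ suc j K.· a))
      inv = ≡.subst (λ m → K.IsInvertible ((x i K.- Λ i) K.+ (K.- x l K.+ m K.· a)))
        (toℕ-fromℕ< 1+j<p) (valueAt0-invertible {inj₂ (l , fromℕ< 1+j<p)} λ ())

    module _ (d : ℕ) (1+d≤p′ : suc d ≤ p′) where

      regular : (j : Fin (suc d)) → Regular Λ a (shift s a (toℕ j)) x
      regular j l = ι-invertible
        (denominator-invertible (toℕ j) (s≤s (ℕ.<-≤-trans (toℕ<n j) 1+d≤p′)) l)

      Φ-at : Fin (suc d) → Laurent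
      Φ-at j = Φ Λ a (shift s a (toℕ j)) x (regular j)

      quotient-at : Fin (suc d) → Fin n → Laurent
      quotient-at j l =
        numerator Λ a (shift s a (toℕ j)) x l
          L./ denominator Λ a (shift s a (toℕ j)) x l by regular j l

      pole-Φ : ∀ j → pole (Φ-at j) ≡ 1
      pole-Φ j = ≡.cong suc (≡.trans (pole-product (quotient-at j) λ _ → ≡.refl) (ℕ.*-zeroʳ n))

      pole-∏Φ : pole (∏ᴸ Φ-at) ≡ suc d
      pole-∏Φ = ≡.trans (pole-product Φ-at pole-Φ) (ℕ.*-identityʳ (suc d))

      εᵖ∣numerator : ε S.^ p ∣ shift s a 0 S.- const (x i) S.+ const (Λ i)
      εᵖ∣numerator = ∣ʳ-respʳ-≈ (S.sym
        (S.trans (S.+-congʳ (xy∙z≈xz∙y s _ _)) (xy∙z≈xz∙y _ _ _))) εᵖ∣factorSeries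

      εᵖ∣Φ : ε S.^ p ∣ series (Φ-at zero)
      εᵖ∣Φ = x∣ʳy⇒x∣ʳzy S.1# (≡.subst (ε S.^ p ∣_)
        (≡.sym (series-product (quotient-at zero)))
        (∣-product (series ∘ quotient-at zero) i
          (∣ʳ-respʳ-≈ (S.*-comm _ (series (numerator Λ a (shift s a 0) x i)))
            (x∣ʳy⇒x∣ʳzy (series (proj₁ (regular zero i))) εᵖ∣numerator))))

      εᵖ∣∏Φ : ε S.^ p ∣ series (∏ᴸ Φ-at)
      εᵖ∣∏Φ = ≡.subst (ε S.^ p ∣_) (≡.sym (series-product Φ-at))
        (∣-product (series ∘ Φ-at) zero εᵖ∣Φ)

      ∏Φ-isO : ∀ N → suc d ℕ.+ N ≤ p → IsO N (∏ᴸ Φ-at)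
      ∏Φ-isO N d+N≤p = ∣series⇒IsO (∏ᴸ Φ-at)
        (≡.subst (λ k → k ℕ.+ N ≤ p) (≡.sym pole-∏Φ) d+N≤p) εᵖ∣∏Φ

lemmaB2 :
  ∀ {c ℓ₁ ℓ₂} (F : HeytingField c ℓ₁ ℓ₂) →
  let open HeytingField F
      open OverField F in
  (p : ℕ) → 2 < p → HasCharacteristic p →
  (n : ℕ) → 1 ≤ n →
  (Λ : Vector Carrier n) → (∀ i → Λ i ∈𝔽 p × ¬ (Λ i ≈ 0#)) →
  (a : Carrier) → ¬ (a ∈𝔽 p) →
  (x⁰ : Vector Carrier n) → FactorsDistinct p Λ a x⁰ →
  (s : Vector Series n) → (∀ i → IsBranch p Λ a x⁰ i (s i)) →
  (i : Fin n) (d : ℕ) → 1 ≤ d → d ≤ p ∸ 1 →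
  Σ[ reg ∈ ((j : Fin d) → Regular Λ a (shift (s i) a (toℕ j)) x⁰) ]
    (let P = ∏ᴸ (λ j → Φ Λ a (shift (s i) a (toℕ j)) x⁰ (reg j)) in
     IsO (p ∸ d) P × IsO 1 P)
lemmaB2 F (suc p′) _ _ n _ Λ _ a _ x⁰ distinct s branch i (suc d) _ d<p′ =
  regular d d<p′ ,
  ∏Φ-isO d d<p′ (p′ ∸ d) (ℕ.≤-reflexive (≡.cong suc (ℕ.m+[n∸m]≡n (ℕ.<⇒≤ d<p′)))) ,
  ∏Φ-isO d d<p′ 1 (≡.subst (_≤ suc p′) (ℕ.+-comm 1 (suc d)) (s≤s d<p′))
  where open Branch.AtBranch F Λ a x⁰ distinct i (s i) (branch i)
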